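{- Let $n\ge 1$ and $j\ge 0$ be integers. The number of permutations $\pi\in Av_n(123)$ with $\gamma^U_\pi\le j$ equals the number of Dyck paths of semi-length $n$ that avoid $U^{j+2}D$.
   Context: $\mathcal{S}_n$ is the set of permutations $\pi=\pi_1\pi_2\dots\pi_n$ of $\{1,\dots,n\}$ in one-line notation, and $Av_n(123)$ is the set of those having no increasing subsequence of length $3$. For an entry $\pi_i$ of $\pi$, let $s_\pi(\pi_i)$ be the biggest sub-string (block of consecutive positions) of $\pi$ that contains $\pi_i$ and all of whose entries are greater than or equal to $\pi_i$. The sub-permutation of $\pi$ generated by $\pi_i$, denoted $g_\pi(\pi_i)$, is the permutation obtained by rescaling $s_\pi(\pi_i)$ (replacing its entries by $1,2,\dots,|s_\pi(\pi_i)|$ in an order-preserving way). Two-line representation: the entries of $\pi\in Av_n(123)$ are split into two decreasing subsequences, an upper line $U$ and a lower line $D$. An entry belongs to $U$ if and only if it covers at least one entry of $D$, where an entry covers another one if it lies to its right and is larger. (Equivalently, $D$ consists of the left-to-right minima of $\pi$, and $U$ of all other entries.) A sub-permutation $g_\pi(\pi_i)$ is decreasing if it avoids the pattern $12$. A decreasing sub-permutation $g_\pi(\pi_i)$ of size $m$ is called trivial if it consists of the first $m$ entries of $\pi$, these all lying on $D$; it is non-trivial if it corresponds to a sequence of $m$ entries in adjacent positions all lying on $U$ (every decreasing sub-permutation is of exactly one of these two kinds). $\gamma^U_\pi$ denotes the size of the biggest non-trivial decreasing sub-permutation of $\pi$ (with $\gamma^U_\pi=0$ if there is none). A Dyck path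 of semi-length $n$ is a sequence of $n$ up steps $U$ and $n$ down steps $D$ in which every prefix contains at least as many $U$'s as $D$'s. It avoids $U^{j+2}D$ if it does not contain, as a sub-string of consecutive steps, $j+2$ steps $U$ immediately followed by a step $D$. -}

module Defs where

open import Data.List.Base using (List; []; _∷_; length; map; filter; concatMap; inits; tails; upTo)
open import Data.List.Extrema.Nat using (argmax; max)
open import Data.List.Membership.Propositional using (_∈_)
open import Data.List.Relation.Binary.Infix.Heterogeneous using (Infix)
open import Data.List.Relation.Binary.Permutation.Propositional using (_↭_)
open import Data.List.Relation.Binary.Prefix.Heterogeneous using (Prefix)
open import Data.List.Relation.Binary.Sublist.Propositional using (_⊆_; []; _∷ʳ_; _∷_)
open import Data.List.Relation.Unary.All using (All; all?)
open import Data.List.Relation.Unary.AllPairs using (AllPairs; allPairs?)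
open import Data.List.Relation.Unary.Any using (Any; any?)
open import Data.List.Relation.Unary.Unique.Propositional using (Unique)
open import Data.Nat.Base using (ℕ; suc; _≤_; _<_)
open import Data.Nat.Properties using (_≟_; _≤?_; _<?_)
open import Data.Product.Base using (_×_; _,_; ∃-syntax)
open import Data.Sum.Base using (inj₁; inj₂; [_,_])
open import Function.Bundles using (_⇔_)
open import Relation.Binary.Definitions using (DecidableEquality)
open import Relation.Binary.PropositionalEquality using (_≡_; refl)
open import Relation.Nullary using (¬_; Dec; yes; no; ¬?; map′; _×-dec_; _⊎-dec_; _→-dec_)
open import Relation.Unary using (Decidable)

import Data.List.Membership.DecPropositional _≟_ as ∈ℕ
import Data.List.Relation.Binary.Sublist.DecPropositional _≟_ as ⊆ℕ

HasCardinality : {A : Set} → (A → Set) → ℕ → Set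
HasCardinality {A} P k =
  ∃[ xs ] Unique xs × (∀ (x : A) → x ∈ xs ⇔ P x) × length xs ≡ k

-- One-line notation: a rearrangement of 1, 2, …, n.
IsPermutation : ℕ → List ℕ → Set
IsPermutation n π = π ↭ map suc (upTo n)

HasIncreasingSubsequence : ℕ → List ℕ → Set
HasIncreasingSubsequence k π =
  ∃[ t ] t ⊆ π × length t ≡ k × AllPairs _<_ t

Avoids123 : List ℕ → Set
Avoids123 π = ¬ HasIncreasingSubsequence 3 π

Avoids12 : List ℕ → Set
Avoids12 π = ¬ HasIncreasingSubsequence 2 π

anySublist? : {P : List ℕ → Set} → Decidable P →
              ∀ xs → Dec (∃[ t ] t ⊆ xs × P t)
anySublist? P? [] = map′ (λ p → [] , [] , p) (λ { (_ , [] , p) → p }) (P? [])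
anySublist? P? (x ∷ xs) =
  map′ [ (λ { (t , t⊆xs , p) → t , x ∷ʳ t⊆xs , p })
       , (λ { (t , t⊆xs , p) → x ∷ t , refl ∷ t⊆xs , p }) ]
       (λ { (t , _ ∷ʳ t⊆xs , p)          → inj₁ (t , t⊆xs , p)
          ; (_ ∷ t , refl ∷ t⊆xs , p)    → inj₂ (t , t⊆xs , p) })
       (anySublist? P? xs ⊎-dec anySublist? (λ t → P? (x ∷ t)) xs)

avoids12? : Decidable Avoids12
avoids12? π =
  ¬? (anySublist? (λ t → (length t ≟ 2) ×-dec allPairs? _<?_ t) π)

substrings : List ℕ → List (List ℕ)
substrings π = concatMap inits (tails π)

-- The substrings containing a whose entries are all ≥ a are closed under
-- union when π has distinct entries, so the longest one is unique.
s : List ℕ → ℕ → List ℕ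
s π a = argmax length []
  (filter (λ t → (a ∈ℕ.∈? t) ×-dec all? (a ≤?_) t) (substrings π))

rescale : List ℕ → List ℕ
rescale t = map (λ a → length (filter (_≤? a) t)) t

g : List ℕ → ℕ → List ℕ
g π a = rescale (s π a)

-- Entries are identified with their values; b ∷ a ∷ [] ⊆ π says that a
-- lies to the right of b in π.
Covers : List ℕ → ℕ → ℕ → Set
Covers π a b = (b ∷ a ∷ [] ⊆ π) × b < a

-- The left-to-right minima.
OnLower : List ℕ → ℕ → Set
OnLower π a = a ∈ π × All (λ b → b ∷ a ∷ [] ⊆ π → a < b) π

OnUpper : List ℕ → ℕ → Set
OnUpper π a = Any (λ b → OnLower π b × Covers π a b) π

onLower? : ∀ π → Decidable (OnLower π)
onLower? π a =
  (a ∈ℕ.∈? π) ×-dec all? (λ b → (b ∷ a ∷ [] ⊆ℕ.⊆? π) →-dec (a <? b)) π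

onUpper? : ∀ π → Decidable (OnUpper π)
onUpper? π a =
  any? (λ b → onLower? π b ×-dec ((b ∷ a ∷ [] ⊆ℕ.⊆? π) ×-dec (b <? a))) π

NonTrivialDecreasing : List ℕ → ℕ → Set
NonTrivialDecreasing π a = Avoids12 (g π a) × All (OnUpper π) (s π a)

nonTrivialDecreasing? : ∀ π → Decidable (NonTrivialDecreasing π)
nonTrivialDecreasing? π a = avoids12? (g π a) ×-dec all? (onUpper? π) (s π a)

γᵁ : List ℕ → ℕ
γᵁ π = max 0 (map (λ a → length (g π a)) (filter (nonTrivialDecreasing? π) π))

data Step : Set where
  U D : Step

_≟ˢ_ : DecidableEquality Step
U ≟ˢ U = yes refl
U ≟ˢ D = no λ ()
D ≟ˢ U = no λ ()
D ≟ˢ D = yes refl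

count : Step → List Step → ℕ
count c w = length (filter (c ≟ˢ_) w)

IsDyckPath : ℕ → List Step → Set
IsDyckPath n w =
  count U w ≡ n × count D w ≡ n × (∀ p → Prefix _≡_ p w → count D p ≤ count U p)

AvoidsFactor : List Step → List Step → Set
AvoidsFactor u w = ¬ Infix _≡_ u w

{-# OPTIONS --safe #-}

-- A 123-avoiding permutation is determined by the positions and values of its
-- left-to-right minima m₁ > m₂ > …, the other (upper) entries being the
-- remaining values in decreasing order.  Recording each minimum mᵢ as
-- D^(mᵢ₋₁ ∸ mᵢ) U (with m₀ = n + 1) and each upper entry as U, and reversing
-- the resulting word, gives a bijection onto Dyck paths.
-- If a is an upper entry then s π a consists of upper entries only and is
-- decreasing, so γᵁ π is the length of the longest block of consecutive upper
-- entries.  Such a block together with the preceding minimum becomes a run of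
-- U steps, so γᵁ π ≤ j says that no run has j + 2 steps.
module Submission where

open import Defs
open import Data.Empty using (⊥; ⊥-elim)
open import Data.List.Base
  using ( List; []; _∷_; [_]; _++_; _∷ʳ_; length; map; replicate; reverse; downFrom; upTo
        ; filter; inits; tails)
open import Data.List.Extrema.Nat
  using (min; argmax-all; argmin-sel; f[xs]≤f[argmax]; max≤v⁺; min≤xs; min≤⊤; xs≤max)
open import Data.List.Membership.Propositional using (_∈_; lose; find)
open import Data.List.Membership.Propositional.Properties
  using (∈-map⁺; ∈-map⁻; ∈-++⁺ˡ; ∈-++⁺ʳ; ∈-++⁻; ∈-concatMap⁺; ∈-concatMap⁻; ∈-filter⁺; ∈-filter⁻; ∈-∃++)
open import Data.List.Properties
  using ( ∷-injectiveʳ; length-map; length-++; ++-assoc; filter-++; reverse-++; reverse-injective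
        ; reverse-involutive; reverse-upTo; unfold-reverse)
open import Data.List.Relation.Binary.Infix.Heterogeneous using (Infix; MkView; fromView; toView)
open import Data.List.Relation.Binary.Permutation.Propositional
  using (_↭_; ↭-refl; ↭-sym; ↭-trans; ↭-prep; ↭-reflexive; ↭⇒↭ₛ)
open import Data.List.Relation.Binary.Permutation.Propositional.Properties
  using (∈-resp-↭; drop-∷; shift; All-resp-↭; ↭-empty-inv; ↭-length; ↭-reverse; filter-↭; map⁺)
open import Data.List.Relation.Binary.Pointwise using (Pointwise-≡⇒≡; ≡⇒Pointwise-≡)
open import Data.List.Relation.Binary.Prefix.Heterogeneous using (Prefix; []; _∷_)
open import Data.List.Relation.Binary.Sublist.Propositional
  using (_⊆_; []; _∷_; from∈; lookup; ⊆-refl)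
  renaming (_∷ʳ_ to _∷ˢ_)
open import Data.List.Relation.Binary.Sublist.Propositional.Properties
  using (++⁺; ++⁺ˡ; ++⁺ʳ; filter⁺; length-mono-≤)
open import Data.List.Relation.Unary.All as All using (All; []; _∷_; all?)
import Data.List.Relation.Unary.All.Properties as All
open import Data.List.Relation.Unary.AllPairs as AllPairs using (AllPairs; []; _∷_)
import Data.List.Relation.Unary.AllPairs.Properties as AllPairs
open import Data.List.Relation.Unary.Any using (here; there)
open import Data.List.Relation.Unary.Unique.Propositional using (Unique)
import Data.List.Relation.Unary.Unique.Propositional.Properties as Unique
open import Data.Nat.Base using (ℕ; zero; suc; _+_; _≤_; _<_; _≥_; _>_; z≤n; s≤s; s≤s⁻¹; z<s)
open import Data.Nat.Induction using (<-rec)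
open import Data.Nat.Properties
open import Data.Product.Base using (_×_; _,_; ∃-syntax; proj₂)
open import Data.Sum.Base using (inj₁; inj₂)
open import Function.Base using (_∘_; id)
open import Function.Bundles using (mk⇔)
open import Relation.Binary.PropositionalEquality
  using (_≡_; _≢_; refl; sym; trans; cong; subst; subst₂; setoid)
open import Relation.Nullary using (¬_; Dec; yes; no; contradiction; _→-dec_; _×-dec_)

import Data.List.Membership.DecPropositional _≟_ as ∈ℕ
import Data.List.Relation.Binary.Sublist.DecPropositional _≟_ as ⊆ℕ
open import Data.List.Relation.Binary.Permutation.Setoid.Properties (setoid ℕ) using (Unique-resp-↭)

-- Ballot words and initial runs of `U` steps.

Ballot : ℕ → List Step → Set
Ballot m v = ∀ a b → v ≡ a ++ b → count U a ≤ m + count D a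

StartBound : ℕ → List Step → Set
StartBound r v = ∀ b → v ≢ replicate (suc r) U ++ b

ballot-U : ∀ {m v} → Ballot m v → Ballot (suc m) (U ∷ v)
ballot-U h []      b eq   = z≤n
ballot-U h (_ ∷ a) b refl = s≤s (h a b refl)

ballot-D : ∀ {m v} → Ballot (suc m) v → Ballot m (D ∷ v)
ballot-D         h []      b eq   = z≤n
ballot-D {m} {v} h (_ ∷ a) b refl = subst (count U a ≤_) (sym (+-suc m _)) (h a b refl)

ballot-U⁻ : ∀ {m v} → Ballot (suc m) (U ∷ v) → Ballot m v
ballot-U⁻ h a b refl = s≤s⁻¹ (h (U ∷ a) b refl)

ballot-D⁻ : ∀ {m v} → Ballot m (D ∷ v) → Ballot (suc m) v
ballot-D⁻ {m} h a b refl = subst (count U a ≤_) (+-suc m _) (h (D ∷ a) b refl)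

-- Descending lists and a recursive form of 123-avoidance.

length-∷ʳ : ∀ (q : List ℕ) x → length (q ∷ʳ x) ≡ suc (length q)
length-∷ʳ q x = trans (length-++ q) (+-comm (length q) 1)

↓ : ℕ → List ℕ
↓ k = map suc (downFrom k)

skip-↭ : ∀ (q : List ℕ) {x xs} → (q ∷ʳ x) ++ xs ↭ q ++ x ∷ xs
skip-↭ q = ↭-reflexive (++-assoc q _ _)

-- When m is an earlier entry, an ascent starting above m completes a 123 with it. The least earlier
-- entry gives the strongest condition, so an induction along the permutation needs only one
-- threshold.
No12Above : ℕ → List ℕ → Set
No12Above m = AllPairs (λ x y → m < x → ¬ x < y)

no12Above-mono : ∀ {m n π} → m ≤ n → No12Above m π → No12Above n π
no12Above-mono m≤n = AllPairs.map (λ f n<x → f (≤-<-trans m≤n n<x))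

data No123 : List ℕ → Set where
  []  : No123 []
  _∷_ : ∀ {x π} → No12Above x π → No123 π → No123 (x ∷ π)

↓-≤ : ∀ k → All (_≤ k) (↓ k)
↓-≤ zero    = []
↓-≤ (suc k) = ≤-refl ∷ All.map m≤n⇒m≤1+n (↓-≤ k)

↓-positive : ∀ k → All (0 <_) (↓ k)
↓-positive k = All.map⁺ (All.universal (λ _ → z<s) (downFrom k))

All-resp-↭⁻ : ∀ {P : ℕ → Set} {xs ys} → xs ↭ ys → All P ys → All P xs
All-resp-↭⁻ xs↭ys ps = All-resp-↭ (↭-sym xs↭ys) ps

∷ʳ-descending : ∀ {x q} → All (x <_) q → AllPairs _>_ q → AllPairs _>_ (q ∷ʳ x)
∷ʳ-descending ps ds = AllPairs.++⁺ ds ([] ∷ []) (All.map (_∷ []) ps)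

-- Completions and their enumeration.

module _ (j : ℕ) where

  -- A completion is a way to continue from a prefix of π with least entry k + 1:
  -- the values 1, …, k are unused, q lists the unused values above k + 1, which
  -- must appear in this order, and at most r upper entries may come next.
  -- In a pending state the next minimum is some value ≤ k + 1, and skip decides
  -- that it is not k + 1, which thereby becomes the last of the upper values.
  mutual
    data Completion : ℕ → List ℕ → ℕ → Set where
      done : ∀ {r} → Completion 0 [] r
      up   : ∀ {k x q r} → Completion k q r → Completion k (x ∷ q) (suc r)
      low  : ∀ {k q r} → Pending k q → Completion (suc k) q r

    data Pending : ℕ → List ℕ → Set where
      skip : ∀ {k q} → Pending k (q ∷ʳ suc (suc k)) → Pending (suc k) q
      take : ∀ {k q} → Completion k q j → Pending k q

  mutual
    -- The search is finite: `low` and `skip` lower k, and `up` shortens q at fixed k.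
    completions : ∀ k q r → List (Completion k q r)
    completions zero    []      r       = [ done ]
    -- A dead end: upper values are left, but the block is full and no smaller minimum remains to
    -- end it.
    completions zero    (x ∷ q) zero    = []
    completions zero    (x ∷ q) (suc r) = map up (completions zero q r)
    completions (suc k) []      r       = map low (pendings k [])
    completions (suc k) (x ∷ q) zero    = map low (pendings k (x ∷ q))
    completions (suc k) (x ∷ q) (suc r) =
      map up (completions (suc k) q r) ++ map low (pendings k (x ∷ q))

    pendings : ∀ k q → List (Pending k q)
    pendings zero    q = map take (completions zero q j)
    pendings (suc k) q =
      map take (completions (suc k) q j) ++ map skip (pendings k (q ∷ʳ suc (suc k)))

  mutual
    ∈-completions : ∀ {k q r} (c : Completion k q r) → c ∈ completions k q r
    ∈-completions done = here refl
    ∈-completions {zero}  (up c) = ∈-map⁺ up (∈-completions c)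
    ∈-completions {suc k} (up c) = ∈-++⁺ˡ (∈-map⁺ up (∈-completions c))
    ∈-completions {q = []}            (low l) = ∈-map⁺ low (∈-pendings l)
    ∈-completions {q = _ ∷ _} {zero}  (low l) = ∈-map⁺ low (∈-pendings l)
    ∈-completions {q = _ ∷ _} {suc r} (low l) = ∈-++⁺ʳ _ (∈-map⁺ low (∈-pendings l))

    ∈-pendings : ∀ {k q} (l : Pending k q) → l ∈ pendings k q
    ∈-pendings         (skip l) = ∈-++⁺ʳ _ (∈-map⁺ skip (∈-pendings l))
    ∈-pendings {zero}  (take c) = ∈-map⁺ take (∈-completions c)
    ∈-pendings {suc k} (take c) = ∈-++⁺ˡ (∈-map⁺ take (∈-completions c))

  mutual
    completions-unique : ∀ k q r → Unique (completions k q r)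
    completions-unique zero    []      r       = [] ∷ []
    completions-unique zero    (x ∷ q) zero    = []
    completions-unique zero    (x ∷ q) (suc r) =
      Unique.map⁺ (λ { refl → refl }) (completions-unique zero q r)
    completions-unique (suc k) []      r       =
      Unique.map⁺ (λ { refl → refl }) (pendings-unique k [])
    completions-unique (suc k) (x ∷ q) zero    =
      Unique.map⁺ (λ { refl → refl }) (pendings-unique k (x ∷ q))
    completions-unique (suc k) (x ∷ q) (suc r) =
      Unique.++⁺ (Unique.map⁺ (λ { refl → refl }) (completions-unique (suc k) q r))
                 (Unique.map⁺ (λ { refl → refl }) (pendings-unique k (x ∷ q)))
                 λ (u , l) → case (∈-map⁻ up u) (∈-map⁻ low l)
      where
      case : ∀ {c} {P : _ → Set} {Q : _ → Set} → ∃[ u ] P u × c ≡ up u → ∃[ l ] Q l × c ≡ low l → ⊥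
      case (_ , _ , refl) (_ , _ , ())

    pendings-unique : ∀ k q → Unique (pendings k q)
    pendings-unique zero    q = Unique.map⁺ (λ { refl → refl }) (completions-unique zero q j)
    pendings-unique (suc k) q =
      Unique.++⁺ (Unique.map⁺ (λ { refl → refl }) (completions-unique (suc k) q j))
                 (Unique.map⁺ (λ { refl → refl }) (pendings-unique k _))
                 λ (t , s) → case (∈-map⁻ take t) (∈-map⁻ skip s)
      where
      case : ∀ {c} {P : _ → Set} {Q : _ → Set} → ∃[ u ] P u × c ≡ take u → ∃[ l ] Q l × c ≡ skip l → ⊥
      case (_ , _ , refl) (_ , _ , ())

  -- Both sides of the theorem are counted by this: one list of completions is mapped bijectively
  -- onto each of them, so the two counts are literally the same number.
  enumeration⇒HasCardinality :
    ∀ {k q r} {B : Set} {P : B → Set} (f : Completion k q r → B) →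
    (∀ {c d} → f c ≡ f d → c ≡ d) →
    (∀ c → P (f c)) → (∀ {x} → P x → ∃[ c ] f c ≡ x) →
    HasCardinality P (length (completions k q r))
  enumeration⇒HasCardinality {k} {q} {r} {P = P} f inj sound complete =
    map f cs , Unique.map⁺ inj (completions-unique k q r) , (λ x → mk⇔ to from) , length-map f cs
    where
    cs = completions k q r
    to : ∀ {x} → x ∈ map f cs → P x
    to x∈ with c , _ , refl ← ∈-map⁻ f x∈ = sound c
    from : ∀ {x} → P x → x ∈ map f cs
    from px with c , refl ← complete px = ∈-map⁺ f (∈-completions c)

  -- The step words of completions.

  mutual
    steps : ∀ {k q r} → Completion k q r → List Step
    steps done    = []
    steps (up c)  = U ∷ steps c
    steps (low l) = D ∷ stepsᴾ l

    stepsᴾ : ∀ {k q} → Pending k q → List Step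
    stepsᴾ (skip l) = D ∷ stepsᴾ l
    stepsᴾ (take c) = U ∷ steps c

  mutual
    -- The first step decides the constructor: `U` for `up` and `take`, `D` for `low` and `skip`.
    steps-injective : ∀ {k q r} (c d : Completion k q r) → steps c ≡ steps d → c ≡ d
    steps-injective done    done    eq = refl
    steps-injective (up c)  (up d)  eq = cong up (steps-injective c d (∷-injectiveʳ eq))
    steps-injective (low l) (low m) eq = cong low (stepsᴾ-injective l m (∷-injectiveʳ eq))

    stepsᴾ-injective : ∀ {k q} (l m : Pending k q) → stepsᴾ l ≡ stepsᴾ m → l ≡ m
    stepsᴾ-injective (skip l) (skip m) eq = cong skip (stepsᴾ-injective l m (∷-injectiveʳ eq))
    stepsᴾ-injective (take c) (take d) eq = cong take (steps-injective c d (∷-injectiveʳ eq))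

  -- The forbidden factor as it appears in the reversed word. After a `D`, the first `U` of a run is
  -- the minimum and the others are the upper entries following it, so length j + 2 is the first to
  -- exceed the bound.
  RunBound : List Step → Set
  RunBound v = ∀ a b → v ≢ a ++ D ∷ replicate (suc (suc j)) U ++ b

  runBound-U : ∀ {v} → RunBound v → RunBound (U ∷ v)
  runBound-U h (_ ∷ a) b refl = h a b refl

  runBound-D : ∀ {v} → StartBound (suc j) v → RunBound v → RunBound (D ∷ v)
  runBound-D s h []      b refl = s b refl
  runBound-D s h (_ ∷ a) b refl = h a b refl

  runBound-∷⁻ : ∀ {x v} → RunBound (x ∷ v) → RunBound v
  runBound-∷⁻ {x} h a b refl = h (x ∷ a) b refl

  Reads : ℕ → ℕ → ℕ → List Step → Set
  Reads k p r v =
    count D v ≡ k × count U v ≡ k + p × Ballot p v × StartBound r v × RunBound v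

  -- The undecided value k + 1 adds one `U` to the count and one to the credit. The next `U` is a
  -- minimum, so an initial run may have j + 1 steps.
  Readsᴾ : ℕ → ℕ → List Step → Set
  Readsᴾ k p v =
    count D v ≡ k × count U v ≡ suc (k + p) × Ballot (suc p) v × StartBound (suc j) v × RunBound v

  mutual
    steps-reads : ∀ {k q r} (c : Completion k q r) → Reads k (length q) r (steps c)
    steps-reads done = refl , refl , (λ { [] b eq → z≤n }) , (λ b ()) , λ { [] b () ; (_ ∷ _) b () }
    steps-reads {k} {_ ∷ q} (up c) with d , u , b , s , h ← steps-reads c =
      d , trans (cong suc u) (sym (+-suc k _)) , ballot-U b ,
      (λ b′ eq → s b′ (∷-injectiveʳ eq)) , runBound-U h
    steps-reads (low l) with d , u , b , s , h ← stepsᴾ-reads l =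
      cong suc d , u , ballot-D b , (λ b′ ()) , runBound-D s h

    stepsᴾ-reads : ∀ {k q} (l : Pending k q) → Readsᴾ k (length q) (stepsᴾ l)
    stepsᴾ-reads {suc k} {q} (skip l) with d , u , b , s , h ← stepsᴾ-reads l =
      cong suc d ,
      trans u (cong suc (trans (cong (k +_) (length-∷ʳ q _)) (+-suc k _))) ,
      ballot-D (subst (λ p → Ballot (suc p) (stepsᴾ l)) (length-∷ʳ q _) b) , (λ b′ ()) , runBound-D s h
    stepsᴾ-reads (take c) with d , u , b , s , h ← steps-reads c =
      d , cong suc u , ballot-U b , (λ b′ eq → s b′ (∷-injectiveʳ eq)) , runBound-U h

  mutual
    -- The word dictates the completion letter by letter. `Ballot` excludes a `U` when q is empty,
    -- `StartBound` excludes one when r is 0, and at each `D` the run bound supplies the start bound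
    -- for what follows.
    reads⇒steps : ∀ {k} q {r} v → Reads k (length q) r v → ∃[ c ] steps {k} {q} {r} c ≡ v
    reads⇒steps []      []      (refl , _ , _) = done , refl
    reads⇒steps (_ ∷ _) []      (refl , () , _)
    reads⇒steps []      (U ∷ v) (_ , _ , b , _) with () ← b [ U ] v refl
    reads⇒steps (_ ∷ q) {zero}  (U ∷ v) (_ , _ , _ , s , _) = ⊥-elim (s v refl)
    reads⇒steps {k} (_ ∷ q) {suc r} (U ∷ v) (d , u , b , s , h)
      with c , refl ← reads⇒steps q v
             ( d , suc-injective (trans u (+-suc k _)) , ballot-U⁻ b
             , (λ b′ eq → s b′ (cong (U ∷_) eq)) , runBound-∷⁻ h) = up c , refl
    reads⇒steps q (D ∷ v) (refl , u , b , s , h)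
      with l , eq ← readsᴾ⇒stepsᴾ q v
             (refl , u , ballot-D⁻ b , (λ b′ eq → h [] b′ (cong (D ∷_) eq)) , runBound-∷⁻ h) =
      low l , cong (D ∷_) eq

    readsᴾ⇒stepsᴾ : ∀ {k} q v → Readsᴾ k (length q) v → ∃[ l ] stepsᴾ {k} {q} l ≡ v
    readsᴾ⇒stepsᴾ q [] (_ , () , _)
    readsᴾ⇒stepsᴾ q (U ∷ v) (d , u , b , s , h)
      with c , refl ← reads⇒steps q v
             (d , suc-injective u , ballot-U⁻ b , (λ b′ eq → s b′ (cong (U ∷_) eq)) , runBound-∷⁻ h) =
      take c , refl
    readsᴾ⇒stepsᴾ q (D ∷ v) (refl , u , b , s , h)
      -- Counting the `D` steps shows that k is `suc (count D v)`, so the value appended is k + 1,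
      -- the one being skipped.
      with l , eq ← readsᴾ⇒stepsᴾ (q ∷ʳ suc (suc (count D v))) v
             ( refl , trans u (cong suc (sym (trans (cong (count D v +_) (length-∷ʳ q _)) (+-suc _ _))))
             , subst (λ p → Ballot (suc p) v) (sym (length-∷ʳ q _)) (ballot-D⁻ b)
             , (λ b′ eq → h [] b′ (cong (D ∷_) eq)) , runBound-∷⁻ h) = skip l , cong (D ∷_) eq

  -- The permutations of completions.

  mutual
    entries : ∀ {k q r} → Completion k q r → List ℕ
    entries done           = []
    entries (up {x = x} c) = x ∷ entries c
    entries (low l)        = entriesᴾ l

    entriesᴾ : ∀ {k q} → Pending k q → List ℕ
    entriesᴾ (skip l)         = entriesᴾ l
    entriesᴾ (take {k = k} c) = suc k ∷ entries c

  -- An intermediate certificate between completions and blocks: each entry is only compared with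
  -- the running minimum k + 1, and the values that occur are left open. A new minimum is written
  -- `suc x` so that x is the next threshold.
  data Runs : ℕ → ℕ → List ℕ → Set where
    []   : ∀ {k r} → Runs k r []
    up   : ∀ {k r x π} → k < x → Runs k r π → Runs k (suc r) (x ∷ π)
    low  : ∀ {k r x π} → x < k → Runs x j π → Runs k r (suc x ∷ π)

  mutual
    entries-runs : ∀ {k q r} (c : Completion k q r) → All (suc k <_) q → Runs k r (entries c)
    entries-runs done    _        = []
    entries-runs (up c)  (p ∷ ps) = up (<⇒≤ p) (entries-runs c ps)
    entries-runs (low l) ps with _ , _ , eq , x≤k , runs ← entriesᴾ-runs l (All.map <⇒≤ ps)
      rewrite eq = low (s≤s x≤k) runs

    entriesᴾ-runs : ∀ {k q} (l : Pending k q) → All (suc k <_) q →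
                    ∃[ x ] ∃[ π ] entriesᴾ l ≡ suc x ∷ π × x ≤ k × Runs x j π
    entriesᴾ-runs (skip l) ps
      with x , π , eq , x≤k , runs ← entriesᴾ-runs l (All.∷ʳ⁺ (All.map <⇒≤ ps) ≤-refl) =
      x , π , eq , m≤n⇒m≤1+n x≤k , runs
    entriesᴾ-runs (take c) ps = _ , _ , refl , ≤-refl , entries-runs c ps

  entriesᴾ-head : ∀ {k q x π} (l : Pending k q) → All (suc k <_) q → entriesᴾ l ≡ x ∷ π → x ≤ suc k
  entriesᴾ-head l ps eq with _ , _ , eq′ , x≤k , _ ← entriesᴾ-runs l ps
    with refl ← trans (sym eq) eq′ = s≤s x≤k

  mutual
    -- The value of the next entry decides the constructor: `up` emits a value above k + 1, whereas
    -- `low` leads to one of at most k. Likewise `take` emits the current candidate and `skip` leads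
    -- to something smaller.
    entries-injective : ∀ {k q r} → All (suc k <_) q → (c d : Completion k q r) →
                        entries c ≡ entries d → c ≡ d
    entries-injective ps       done    done    eq = refl
    entries-injective (_ ∷ ps) (up c)  (up d)  eq =
      cong up (entries-injective ps c d (∷-injectiveʳ eq))
    entries-injective (p ∷ ps) (up c)  (low m) eq =
      contradiction (<⇒≤ p) (≤⇒≯ (entriesᴾ-head m (All.map <⇒≤ (p ∷ ps)) (sym eq)))
    entries-injective (p ∷ ps) (low l) (up d)  eq =
      contradiction (<⇒≤ p) (≤⇒≯ (entriesᴾ-head l (All.map <⇒≤ (p ∷ ps)) eq))
    entries-injective ps       (low l) (low m) eq =
      cong low (entriesᴾ-injective (All.map <⇒≤ ps) l m eq)

    entriesᴾ-injective : ∀ {k q} → All (suc k <_) q → (l m : Pending k q) →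
                         entriesᴾ l ≡ entriesᴾ m → l ≡ m
    entriesᴾ-injective ps (skip l) (skip m) eq =
      cong skip (entriesᴾ-injective (All.∷ʳ⁺ (All.map <⇒≤ ps) ≤-refl) l m eq)
    entriesᴾ-injective ps (skip l) (take d) eq =
      contradiction ≤-refl (≤⇒≯ (entriesᴾ-head l (All.∷ʳ⁺ (All.map <⇒≤ ps) ≤-refl) eq))
    entriesᴾ-injective ps (take c) (skip m) eq =
      contradiction ≤-refl (≤⇒≯ (entriesᴾ-head m (All.∷ʳ⁺ (All.map <⇒≤ ps) ≤-refl) (sym eq)))
    entriesᴾ-injective ps (take c) (take d) eq =
      cong take (entries-injective ps c d (∷-injectiveʳ eq))

  mutual
    entries-↭ : ∀ {k q r} (c : Completion k q r) → entries c ↭ q ++ ↓ k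
    entries-↭ done    = ↭-refl
    entries-↭ (up c)  = ↭-prep _ (entries-↭ c)
    entries-↭ (low l) = entriesᴾ-↭ l

    entriesᴾ-↭ : ∀ {k q} (l : Pending k q) → entriesᴾ l ↭ q ++ ↓ (suc k)
    entriesᴾ-↭ {q = q} (skip l) = ↭-trans (entriesᴾ-↭ l) (skip-↭ q)
    entriesᴾ-↭ {q = q} (take c) = ↭-trans (↭-prep _ (entries-↭ c)) (↭-sym (shift _ q _))

  mutual
    -- Entries above the running minimum are emitted in the decreasing order of q, so none of them
    -- starts an ascent. When `take` emits a minimum, this condition on the remaining entries is
    -- exactly what `No123` asks at that entry.
    entries-no123 : ∀ {k q r} (c : Completion k q r) → All (suc k <_) q → AllPairs _>_ q →
                    No12Above (suc k) (entries c) × No123 (entries c)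
    entries-no123 done _ _ = [] , []
    entries-no123 {k} (up c) (p ∷ ps) (d ∷ ds) with no12 , no123 ← entries-no123 c ps ds =
      All.map (λ y<x _ → <⇒≯ y<x) (All-resp-↭⁻ (entries-↭ c)
        (All.++⁺ d (All.map (λ y≤k → ≤-<-trans (m≤n⇒m≤1+n y≤k) p) (↓-≤ k)))) ∷ no12 ,
      no12Above-mono (<⇒≤ p) no12 ∷ no123
    entries-no123 (low l) ps ds with no12 , no123 ← entriesᴾ-no123 l (All.map <⇒≤ ps) ds =
      no12Above-mono (n≤1+n _) no12 , no123

    entriesᴾ-no123 : ∀ {k q} (l : Pending k q) → All (suc k <_) q → AllPairs _>_ q →
                     No12Above (suc k) (entriesᴾ l) × No123 (entriesᴾ l)
    entriesᴾ-no123 (skip l) ps ds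
      with no12 , no123 ← entriesᴾ-no123 l (All.∷ʳ⁺ (All.map <⇒≤ ps) ≤-refl) (∷ʳ-descending ps ds) =
      no12Above-mono (n≤1+n _) no12 , no123
    entriesᴾ-no123 (take c) ps ds with no12 , no123 ← entries-no123 c ps ds =
      All.universal (λ _ k<k → contradiction k<k (<-irrefl refl)) _ ∷ no12 , no12 ∷ no123

  mutual
    -- An entry above the threshold must be the head of q. If it were deeper in q, the larger head
    -- would still follow it in π, giving an ascent above the running minimum.
    runs⇒entries : ∀ {k q r π} → Runs k r π → π ↭ q ++ ↓ k → All (suc k <_) q → AllPairs _>_ q →
               No12Above (suc k) π → No123 π → ∃[ c ] entries {k} {q} {r} c ≡ π
    runs⇒entries {zero} {[]} [] eq _ _ _ _ = done , refl
    runs⇒entries {suc k} {[]} [] eq _ _ _ _ with () ← ↭-empty-inv (↭-sym eq)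
    runs⇒entries {q = _ ∷ _} [] eq _ _ _ _ with () ← ↭-empty-inv (↭-sym eq)
    runs⇒entries {k} {q} (up {x = x} k<x runs) eq ps ds (x≮ ∷ no12) (_ ∷ no123)
      with ∈-++⁻ q (∈-resp-↭ eq (here refl))
    ... | inj₂ x∈↓ = contradiction k<x (≤⇒≯ (All.lookup (↓-≤ k) x∈↓))
    runs⇒entries {k} {y ∷ q} (up k<x runs) eq (p ∷ ps) (d ∷ ds) (x≮ ∷ no12) (_ ∷ no123)
      | inj₁ (here refl) with c , eq′ ← runs⇒entries runs (drop-∷ eq) ps ds no12 no123 =
      up c , cong (_ ∷_) eq′
    runs⇒entries {k} {y ∷ q} (up k<x runs) eq (p ∷ ps) (d ∷ ds) (x≮ ∷ no12) (_ ∷ no123)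
      | inj₁ (there x∈q) with ∈-resp-↭ (↭-sym eq) (here refl)
    ... | here refl = contradiction (All.lookup d x∈q) (<-irrefl refl)
    ... | there y∈π =
      contradiction (All.lookup d x∈q) (All.lookup x≮ y∈π (All.lookup ps x∈q))
    runs⇒entries {suc k} (low (s≤s x≤k) runs) eq ps ds _ no123
      with l , eq′ ← runs⇒entriesᴾ runs x≤k eq (All.map <⇒≤ ps) ds no123 = low l , eq′

    -- The values between the old minimum and the new one are skipped from the top down, which keeps
    -- q descending as they are appended.
    runs⇒entriesᴾ : ∀ {k q x π} → Runs x j π → x ≤ k → suc x ∷ π ↭ q ++ ↓ (suc k) →
                All (suc k <_) q → AllPairs _>_ q → No123 (suc x ∷ π) →
                ∃[ l ] entriesᴾ {k} {q} l ≡ suc x ∷ π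
    runs⇒entriesᴾ {k} {q} {x} runs x≤k eq ps ds no123 with m≤n⇒m<n∨m≡n x≤k
    runs⇒entriesᴾ {k} {q} runs x≤k eq ps ds (no12 ∷ no123) | inj₂ refl
      with c , eq′ ← runs⇒entries runs (drop-∷ (↭-trans eq (shift _ q _))) ps ds no12 no123 =
      take c , cong (_ ∷_) eq′
    runs⇒entriesᴾ {suc k} {q} runs x≤k eq ps ds no123 | inj₁ (s≤s x≤k′)
      with l , eq′ ← runs⇒entriesᴾ runs x≤k′ (↭-trans eq (↭-sym (skip-↭ q)))
                       (All.∷ʳ⁺ (All.map <⇒≤ ps) ≤-refl) (∷ʳ-descending ps ds) no123 =
      skip l , eq′

-- Upper entries and γᵁ

allPairs⇒ : ∀ {A : Set} {R : A → A → Set} {xs x y} → AllPairs R xs → x ∷ y ∷ [] ⊆ xs → R x y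
allPairs⇒ (_ ∷ rs) (_ ∷ˢ s)   = allPairs⇒ rs s
allPairs⇒ (r ∷ _)  (refl ∷ s) = All.lookup r (lookup s (here refl))

⇒allPairs : ∀ {A : Set} {R : A → A → Set} xs → (∀ {x y} → x ∷ y ∷ [] ⊆ xs → R x y) → AllPairs R xs
⇒allPairs []       f = []
⇒allPairs (x ∷ xs) f = All.tabulate (λ y∈ → f (refl ∷ from∈ y∈)) ∷ ⇒allPairs xs (f ∘ (x ∷ˢ_))

no123⇒avoids123 : ∀ {π} → No123 π → Avoids123 π
no123⇒avoids123 (_ ∷ no123) (t , _ ∷ˢ s , eq , inc) = no123⇒avoids123 no123 (t , s , eq , inc)
no123⇒avoids123 (no12 ∷ _) (x ∷ y ∷ z ∷ [] , refl ∷ s , eq , (x<y ∷ _) ∷ (y<z ∷ _) ∷ _) =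
  allPairs⇒ no12 s x<y y<z

avoids123⇒no123 : ∀ π → Avoids123 π → No123 π
avoids123⇒no123 []      av = []
avoids123⇒no123 (x ∷ π) av =
  ⇒allPairs π (λ s x<y y<z → av (_ , refl ∷ s , refl , (x<y ∷ <-trans x<y y<z ∷ []) ∷ (y<z ∷ []) ∷ [] ∷ [])) ∷
  avoids123⇒no123 π (λ (t , s , rest) → av (t , x ∷ˢ s , rest))

precedes-++⁺ : ∀ {A : Set} {xs ys : List A} {x y} → x ∈ xs → y ∈ ys → x ∷ y ∷ [] ⊆ xs ++ ys
precedes-++⁺ x∈ y∈ = ++⁺ (from∈ x∈) (from∈ y∈)

precedes-++⁻ : ∀ {A : Set} (xs : List A) {ys x y} → Unique (xs ++ y ∷ ys) → x ∷ y ∷ [] ⊆ xs ++ y ∷ ys → x ∈ xs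
precedes-++⁻ []       (y∉ ∷ _) (_ ∷ˢ s)   = contradiction refl (All.lookup y∉ (lookup s (there (here refl))))
precedes-++⁻ []       (y∉ ∷ _) (refl ∷ s) = contradiction refl (All.lookup y∉ (lookup s (here refl)))
precedes-++⁻ (_ ∷ xs) (_ ∷ u)  (_ ∷ˢ s)   = there (precedes-++⁻ xs u s)
precedes-++⁻ (_ ∷ xs) _        (refl ∷ s) = here refl

precedes-trans : ∀ {A : Set} {xs : List A} {x y z} → Unique xs →
                 x ∷ y ∷ [] ⊆ xs → y ∷ z ∷ [] ⊆ xs → x ∷ z ∷ [] ⊆ xs
precedes-trans (_ ∷ u)  (_ ∷ˢ s)   (_ ∷ˢ t)   = _ ∷ˢ precedes-trans u s t
precedes-trans (y∉ ∷ _) (_ ∷ˢ s)   (refl ∷ t) =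
  contradiction refl (All.lookup y∉ (lookup s (there (here refl))))
precedes-trans (_ ∷ u)  (refl ∷ s) (_ ∷ˢ t)   = refl ∷ from∈ (lookup t (there (here refl)))
precedes-trans (y∉ ∷ _) (refl ∷ s) (refl ∷ t) = contradiction refl (All.lookup y∉ (lookup s (here refl)))

-- The covered entry need not lie on the lower line, which makes this easier to establish than
-- `OnUpper`; for distinct entries the two agree.
CoversSome : List ℕ → ℕ → Set
CoversSome π a = ∃[ b ] Covers π a b

onUpper⇒coversSome : ∀ {π a} → OnUpper π a → CoversSome π a
onUpper⇒coversSome upper with b , _ , _ , covers ← find upper = b , covers

-- Descent on the covered value: if b is not a left-to-right minimum, some smaller c stands before
-- it, and by transitivity a covers c as well.
coversSome⇒onUpper : ∀ {π a} → Unique π → CoversSome π a → OnUpper π a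
coversSome⇒onUpper {π} {a} u (b , covers) =
  <-rec (λ b → Covers π a b → OnUpper π a) descend b covers
  where
  descend : ∀ b → (∀ {c} → c < b → Covers π a c → OnUpper π a) → Covers π a b → OnUpper π a
  descend b rec (b≺a , b<a) with all? (λ c → (c ∷ b ∷ [] ⊆ℕ.⊆? π) →-dec (b <? c)) π
  ... | yes b-min = lose b∈π ((b∈π , b-min) , b≺a , b<a)
    where b∈π = lookup b≺a (here refl)
  ... | no ¬b-min
    with c , _ , ¬b<c ← find (All.¬All⇒Any¬ (λ c → (c ∷ b ∷ [] ⊆ℕ.⊆? π) →-dec (b <? c)) π ¬b-min)
    with c ∷ b ∷ [] ⊆ℕ.⊆? π
  ... | no  c⊀b = contradiction (λ c≺b → contradiction c≺b c⊀b) ¬b<c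
  ... | yes c≺b = rec c<b (precedes-trans u c≺b b≺a , <-trans c<b b<a)
    where c<b = ≤∧≢⇒< (≮⇒≥ (λ b<c → ¬b<c (λ _ → b<c))) (allPairs⇒ u c≺b)

-- Substrings and the maximal substring `s`.

inits⁺ : ∀ {A : Set} (xs ys : List A) → xs ∈ inits (xs ++ ys)
inits⁺ []       ys = here refl
inits⁺ (x ∷ xs) ys = there (∈-map⁺ (x ∷_) (inits⁺ xs ys))

inits⁻ : ∀ {A : Set} (xs : List A) {t} → t ∈ inits xs → ∃[ ys ] xs ≡ t ++ ys
inits⁻ xs       (here refl) = xs , refl
inits⁻ (x ∷ xs) (there t∈) with t , t∈′ , refl ← ∈-map⁻ (x ∷_) t∈
  with ys , refl ← inits⁻ xs t∈′ = ys , refl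

tails⁺ : ∀ {A : Set} (xs ys : List A) → ys ∈ tails (xs ++ ys)
tails⁺ []       ys = here refl
tails⁺ (x ∷ xs) ys = there (tails⁺ xs ys)

tails⁻ : ∀ {A : Set} (xs : List A) {t} → t ∈ tails xs → ∃[ ys ] xs ≡ ys ++ t
tails⁻ xs       (here refl) = [] , refl
tails⁻ (x ∷ xs) (there t∈) with ys , refl ← tails⁻ xs t∈ = x ∷ ys , refl

substrings⁺ : ∀ ls t rs → t ∈ substrings (ls ++ t ++ rs)
substrings⁺ ls t rs = ∈-concatMap⁺ inits (lose (tails⁺ ls (t ++ rs)) (inits⁺ t rs))

substrings⁻ : ∀ π {t} → t ∈ substrings π → ∃[ ls ] ∃[ rs ] π ≡ ls ++ t ++ rs
substrings⁻ π t∈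
  with ts , ts∈ , t∈ts ← find (∈-concatMap⁻ inits {xs = tails π} t∈)
  with ls , refl ← tails⁻ π ts∈
  with rs , refl ← inits⁻ ts t∈ts = ls , rs , refl

candidate? : ∀ a t → Dec (a ∈ t × All (a ≤_) t)
candidate? a t = (a ∈ℕ.∈? t) ×-dec all? (a ≤?_) t

s-maximal : ∀ {a} ls t rs → a ∈ t → All (a ≤_) t → length t ≤ length (s (ls ++ t ++ rs) a)
s-maximal {a} ls t rs a∈t a≤t =
  All.lookup (f[xs]≤f[argmax] {f = length} [] _)
    (∈-filter⁺ (candidate? a) (substrings⁺ ls t rs) (a∈t , a≤t))

-- `argmax` returns either a candidate or its default `[]`, whence the separate case `P []`.
s-elim : ∀ π a (P : List ℕ → Set) → P [] →
         (∀ ls t rs → π ≡ ls ++ t ++ rs → a ∈ t → All (a ≤_) t → P t) → P (s π a)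
s-elim π a P p[] p = argmax-all length {P = P} p[] (All.tabulate candidate)
  where
  candidate : ∀ {t} → t ∈ filter (candidate? a) (substrings π) → P t
  candidate t∈ with t∈′ , a∈t , a≤t ← ∈-filter⁻ (candidate? a) {xs = substrings π} t∈
    with ls , rs , eq ← substrings⁻ π t∈′ = p ls _ rs eq a∈t a≤t

⊆-map⁻ : ∀ {A B : Set} (f : A → B) xs {zs} → zs ⊆ map f xs → ∃[ ys ] ys ⊆ xs × zs ≡ map f ys
⊆-map⁻ f []       []       = [] , [] , refl
⊆-map⁻ f (x ∷ xs) (_ ∷ˢ s) with ys , s′ , refl ← ⊆-map⁻ f xs s = ys , x ∷ˢ s′ , refl
⊆-map⁻ f (x ∷ xs) (refl ∷ s) with ys , s′ , refl ← ⊆-map⁻ f xs s = x ∷ ys , refl ∷ s′ , refl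

rank-mono : ∀ t {x y} → x ≤ y → length (filter (_≤? x) t) ≤ length (filter (_≤? y) t)
rank-mono t x≤y =
  length-mono-≤ (filter⁺ (_≤? _) (_≤? _) (λ { refl z≤x → ≤-trans z≤x x≤y }) (⊆-refl {x = t}))

-- Ranks are weakly monotone in the values, so an ascent of ranks can only come from an ascent of
-- values.
avoids12-rescale : ∀ t → (∀ {x y} → x ∷ y ∷ [] ⊆ t → ¬ x < y) → Avoids12 (rescale t)
avoids12-rescale t no12 (u , u⊆ , len , inc)
  with ⊆-map⁻ (λ a → length (filter (_≤? a) t)) t u⊆
avoids12-rescale t no12 (_ , _ , _ , (r ∷ []) ∷ _) | x ∷ y ∷ [] , s , refl =
  no12 s (≰⇒> (λ y≤x → <⇒≱ r (rank-mono t y≤x)))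

-- The covered entry precedes a but is too small to lie in t, so it stands to the left of all of t.
covered-before : ∀ {a} ls t rs → Unique (ls ++ t ++ rs) → a ∈ t → All (a ≤_) t →
                 CoversSome (ls ++ t ++ rs) a → ∃[ b ] b ∈ ls × b < a
covered-before {a} ls t rs u a∈t a≤t (b , b≺a , b<a)
  with t₁ , t₂ , refl ← ∈-∃++ a∈t
  with ∈-++⁻ ls (precedes-++⁻ (ls ++ t₁) (subst Unique eq u) (subst (_ ⊆_) eq b≺a))
  where
  eq : ls ++ (t₁ ++ a ∷ t₂) ++ rs ≡ (ls ++ t₁) ++ a ∷ t₂ ++ rs
  eq = trans (cong (ls ++_) (++-assoc t₁ _ rs)) (sym (++-assoc ls t₁ _))
... | inj₁ b∈ls = b , b∈ls , b<a
... | inj₂ b∈t₁ = contradiction b<a (≤⇒≯ (All.lookup a≤t (∈-++⁺ˡ b∈t₁)))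

-- Every candidate t for `s π a` has to its right-hand side of some b only entries above b: an
-- ascent in t would complete a 123 with b, and each entry of t covers b.
coversSome⇒nonTrivialDecreasing : ∀ {π a} → Unique π → Avoids123 π → CoversSome π a →
                                  NonTrivialDecreasing π a
coversSome⇒nonTrivialDecreasing {π} {a} u av covers =
  s-elim π a (λ t → Avoids12 (rescale t) × All (OnUpper π) t)
    ((λ { (_ , [] , () , _) }) , []) candidate
  where
  candidate : ∀ ls t rs → π ≡ ls ++ t ++ rs → a ∈ t → All (a ≤_) t →
              Avoids12 (rescale t) × All (OnUpper π) t
  candidate ls t rs refl a∈t a≤t with b , b∈ls , b<a ← covered-before ls t rs u a∈t a≤t covers =
    avoids12-rescale t (λ {x} {y} s x<y →
      let b<x = <-≤-trans b<a (All.lookup a≤t (lookup s (here refl))) in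
      av ( b ∷ x ∷ y ∷ [] , ++⁺ (from∈ b∈ls) (++⁺ʳ rs s) , refl
         , (b<x ∷ <-trans b<x x<y ∷ []) ∷ (x<y ∷ []) ∷ [] ∷ [])) ,
    All.tabulate (λ x∈t → coversSome⇒onUpper u
      (b , precedes-++⁺ b∈ls (∈-++⁺ˡ x∈t) , <-≤-trans b<a (All.lookup a≤t x∈t)))

-- Blocks of upper entries and their lengths.

BlockBound : (ℕ → Set) → ℕ → List ℕ → Set
BlockBound B j π = ∀ ls t rs → π ≡ ls ++ t ++ rs → All B t → length t ≤ j

γᵁ≤⇒blockBound : ∀ {π j} → Unique π → Avoids123 π → γᵁ π ≤ j → BlockBound (CoversSome π) j π
γᵁ≤⇒blockBound u av γ≤j ls [] rs eq upper = z≤n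
γᵁ≤⇒blockBound {π} {j} u av γ≤j ls t@(x ∷ t′) rs refl upper = begin
  length t                     ≤⟨ s-maximal ls t rs a∈t a≤t ⟩
  length (s π a)               ≡⟨ length-map _ (s π a) ⟨
  length (g π a)               ≤⟨ All.lookup (xs≤max 0 _) (∈-map⁺ (length ∘ g π) a∈) ⟩
  γᵁ π                         ≤⟨ γ≤j ⟩
  j                            ∎
  where
  open ≤-Reasoning
  -- The least entry of the block makes the whole block a candidate for `s π a`.
  a = min x t′
  a∈t : a ∈ t
  a∈t with argmin-sel id x t′
  ... | inj₁ eq = here eq
  ... | inj₂ a∈t′ = there a∈t′
  a≤t : All (a ≤_) t
  a≤t = min≤⊤ x t′ ∷ min≤xs x t′
  a∈ : a ∈ filter (nonTrivialDecreasing? π) π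
  a∈ = ∈-filter⁺ (nonTrivialDecreasing? π) (∈-++⁺ʳ ls (∈-++⁺ˡ a∈t))
         (coversSome⇒nonTrivialDecreasing u av (All.lookup upper a∈t))

-- Whenever a contributes to `γᵁ`, the string `s π a` is itself a block of upper entries, or empty.
blockBound⇒γᵁ≤ : ∀ {π j} → BlockBound (CoversSome π) j π → γᵁ π ≤ j
blockBound⇒γᵁ≤ {π} {j} bound = max≤v⁺ z≤n (All.map⁺ (All.tabulate g≤j))
  where
  g≤j : ∀ {a} → a ∈ filter (nonTrivialDecreasing? π) π → length (g π a) ≤ j
  g≤j {a} a∈ with _ , _ , upper ← ∈-filter⁻ (nonTrivialDecreasing? π) {xs = π} a∈ =
    subst (_≤ j) (sym (length-map _ (s π a)))
      (s-elim π a (λ t → All (OnUpper π) t → length t ≤ j) (λ _ → z≤n)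
        (λ ls t rs eq _ _ upper → bound ls t rs eq (All.map onUpper⇒coversSome upper)) upper)

-- Holds for k + 1 = min ls, and for empty ls when k bounds the entries.
Threshold : List ℕ → ℕ → List ℕ → Set
Threshold ls k = All (λ y → (k < y → ∃[ b ] b ∈ ls × b < y) × (∀ b → b ∈ ls → b < y → k < y))

∷ʳ-assoc : ∀ {π} ls {x : ℕ} {rs} → π ≡ ls ++ x ∷ rs → π ≡ (ls ∷ʳ x) ++ rs
∷ʳ-assoc ls eq = trans eq (sym (++-assoc ls _ _))

threshold-∷ʳ-up : ∀ {ls k x rs} → k < x → Threshold ls k rs → Threshold (ls ∷ʳ x) k rs
threshold-∷ʳ-up {ls} {k} {x} k<x = All.map (λ (f , h) →
  (λ k<y → let b , b∈ , b<y = f k<y in b , ∈-++⁺ˡ b∈ , b<y) , back h)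
  where
  back : ∀ {y} → (∀ b → b ∈ ls → b < y → k < y) → ∀ b → b ∈ ls ∷ʳ x → b < y → k < y
  back h b b∈ b<y with ∈-++⁻ ls b∈
  ... | inj₁ b∈ls = h b b∈ls b<y
  ... | inj₂ (here refl) = <-trans k<x b<y

-- The new minimum `suc x` is the witness for every later y above x; distinctness of entries makes
-- the comparison strict.
threshold-∷ʳ-low : ∀ {ls k x rs} → x < k → All (suc x ≢_) rs →
                     Threshold ls k rs → Threshold (ls ∷ʳ suc x) x rs
threshold-∷ʳ-low {ls} {k} {x} x<k ≢s th = All.zipWith (λ (≢y , _ , h) →
  (λ x<y → suc x , ∈-++⁺ʳ ls (here refl) , ≤∧≢⇒< x<y ≢y) , back h) (≢s , th)
  where
  back : ∀ {y} → (∀ b → b ∈ ls → b < y → k < y) → ∀ b → b ∈ ls ∷ʳ suc x → b < y → x < y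
  back h b b∈ b<y with ∈-++⁻ ls b∈
  ... | inj₁ b∈ls = <-trans x<k (h b b∈ls b<y)
  ... | inj₂ (here refl) = <⇒≤ b<y

module _ {π : List ℕ} (u : Unique π) where

  head≢ : ∀ ls {x rs} → π ≡ ls ++ x ∷ rs → All (x ≢_) rs
  head≢ ls refl = All.tabulate (λ y∈ → allPairs⇒ u (++⁺ˡ ls (refl ∷ from∈ y∈)))

  threshold⇒coversSome : ∀ ls {k x rs} → π ≡ ls ++ x ∷ rs → Threshold ls k (x ∷ rs) →
                         k < x → CoversSome π x
  threshold⇒coversSome ls refl ((f , _) ∷ _) k<x with b , b∈ , b<x ← f k<x =
    b , precedes-++⁺ b∈ (here refl) , b<x

  coversSome⇒threshold : ∀ ls {k x rs} → π ≡ ls ++ x ∷ rs → Threshold ls k (x ∷ rs) →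
                         CoversSome π x → k < x
  coversSome⇒threshold ls refl ((_ , h) ∷ _) (b , b≺x , b<x) = h b (precedes-++⁻ ls u b≺x) b<x

  StartBlockBound : ℕ → List ℕ → Set
  StartBlockBound r rs = ∀ t rs′ → rs ≡ t ++ rs′ → All (CoversSome π) t → length t ≤ r

  -- By `Threshold`, the entries read by `up` are those that cover something, and a minimum ends
  -- every block. The start bound r limits the block in progress, and r ≤ j turns it into a block
  -- bound.
  runs⇒blockBound : ∀ {j k r rs} ls → r ≤ j → π ≡ ls ++ rs → Threshold ls k rs → Runs j k r rs →
                    StartBlockBound r rs × BlockBound (CoversSome π) j rs
  runs⇒blockBound ls r≤j eq th [] = (λ { [] _ _ _ → z≤n }) , λ { [] [] _ _ _ → z≤n }
  runs⇒blockBound {j} ls r≤j eq th@(_ ∷ th′) (up {r = r} {x = x} {π = rs} k<x runs)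
    with start , bound ← runs⇒blockBound (ls ∷ʳ x) (<⇒≤ r≤j) (∷ʳ-assoc ls eq) (threshold-∷ʳ-up k<x th′) runs =
    start′ , bound′
    where
    start′ : StartBlockBound (suc r) (x ∷ rs)
    start′ [] _ _ _ = z≤n
    start′ (_ ∷ t) rs′ refl (_ ∷ ups) = s≤s (start t rs′ refl ups)
    bound′ : BlockBound (CoversSome π) j (x ∷ rs)
    bound′ [] t rs′ eq ups = ≤-trans (start′ t rs′ eq ups) r≤j
    bound′ (_ ∷ ls′) t rs′ refl ups = bound ls′ t rs′ refl ups
  runs⇒blockBound {j} {r = r} ls r≤j eq th@(_ ∷ th′) (low {k = k} {x = x} {π = rs} x<k runs)
    with start , bound ← runs⇒blockBound (ls ∷ʳ suc x) ≤-refl (∷ʳ-assoc ls eq)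
                            (threshold-∷ʳ-low x<k (head≢ ls eq) th′) runs =
    start′ , bound′
    where
    start′ : StartBlockBound r (suc x ∷ rs)
    start′ [] _ _ _ = z≤n
    start′ (_ ∷ t) rs′ refl (upper ∷ _) =
      contradiction x<k (≤⇒≯ (s≤s⁻¹ (coversSome⇒threshold ls eq th upper)))
    bound′ : BlockBound (CoversSome π) j (suc x ∷ rs)
    bound′ [] t rs′ eq ups = ≤-trans (start′ t rs′ eq ups) r≤j
    bound′ (_ ∷ ls′) t rs′ refl ups = bound ls′ t rs′ refl ups

  -- Each entry is classified by comparison with the threshold. With r at 0, an upper entry would
  -- already be a block that is too long.
  blockBound⇒runs : ∀ {j k r} ls rs → π ≡ ls ++ rs → All (0 <_) rs → Threshold ls k rs →
                    StartBlockBound r rs → BlockBound (CoversSome π) j rs → Runs j k r rs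
  blockBound⇒runs ls [] _ _ _ _ _ = []
  blockBound⇒runs {k = k} ls (suc x ∷ rs) eq (_ ∷ pos) th start bound with k <? suc x
  blockBound⇒runs {r = r} ls (suc x ∷ rs) eq (_ ∷ pos) th@(_ ∷ th′) start bound | no k≮x =
    low x<k (blockBound⇒runs (ls ∷ʳ suc x) rs (∷ʳ-assoc ls eq) pos (threshold-∷ʳ-low x<k (head≢ ls eq) th′)
      -- After a minimum the allowance is reset to j, by the block bound at offset one.
      (λ t rs′ eq → bound [ suc x ] t rs′ (cong (suc x ∷_) eq))
      (λ ls′ t rs′ eq → bound (suc x ∷ ls′) t rs′ (cong (suc x ∷_) eq)))
    where x<k = ≮⇒≥ k≮x
  blockBound⇒runs {r = zero} ls (suc x ∷ rs) eq _ th start bound | yes k<x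
    with () ← start [ suc x ] rs refl (threshold⇒coversSome ls eq th k<x ∷ [])
  blockBound⇒runs {r = suc r} ls (suc x ∷ rs) eq (_ ∷ pos) th@(_ ∷ th′) start bound | yes k<x =
    up k<x (blockBound⇒runs (ls ∷ʳ suc x) rs (∷ʳ-assoc ls eq) pos (threshold-∷ʳ-up k<x th′)
      (λ t rs′ eq′ ups → s≤s⁻¹ (start (suc x ∷ t) rs′ (cong (suc x ∷_) eq′)
        (threshold⇒coversSome ls eq th k<x ∷ ups)))
      (λ ls′ t rs′ eq → bound (suc x ∷ ls′) t rs′ (cong (suc x ∷_) eq)))

-- Dyck paths

infix-++⁺ : ∀ {A : Set} (xs : List A) {ys zs} → Infix _≡_ ys (xs ++ ys ++ zs)
infix-++⁺ xs {ys} {zs} = fromView (MkView xs (≡⇒Pointwise-≡ refl) zs)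

infix-++⁻ : ∀ {A : Set} {ys xs : List A} → Infix _≡_ ys xs → ∃[ as ] ∃[ bs ] xs ≡ as ++ ys ++ bs
infix-++⁻ i with MkView as pw bs ← toView i with refl ← Pointwise-≡⇒≡ pw = as , bs , refl

prefix-++⁺ : ∀ {A : Set} (xs : List A) {ys} → Prefix _≡_ xs (xs ++ ys)
prefix-++⁺ []       = []
prefix-++⁺ (x ∷ xs) = refl ∷ prefix-++⁺ xs

prefix-++⁻ : ∀ {A : Set} {xs zs : List A} → Prefix _≡_ xs zs → ∃[ ys ] zs ≡ xs ++ ys
prefix-++⁻ []         = _ , refl
prefix-++⁻ (refl ∷ p) with ys , refl ← prefix-++⁻ p = ys , refl

count-reverse : ∀ x w → count x (reverse w) ≡ count x w
count-reverse x w = ↭-length (filter-↭ (x ≟ˢ_) (↭-reverse w))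

count-++ : ∀ x v w → count x (v ++ w) ≡ count x v + count x w
count-++ x v w = trans (cong length (filter-++ (x ≟ˢ_) v w)) (length-++ (filter (x ≟ˢ_) v))

-- Used for a balanced word cut in two: a surplus of one step in one piece is a deficit in the
-- other, which translates prefix conditions under reversal.
complement-≤ : ∀ {a b c d} → a + b ≡ c + d → d ≤ b → a ≤ c
complement-≤ {a} {b} {c} {d} eq d≤b =
  +-cancelʳ-≤ d a c (≤-trans (+-monoʳ-≤ a d≤b) (≤-reflexive eq))

balanced-split : ∀ {n} a b → count U (a ++ b) ≡ n → count D (a ++ b) ≡ n →
                 count U a + count U b ≡ count D a + count D b
balanced-split a b u d =
  trans (sym (count-++ U a b)) (trans u (trans (sym d) (count-++ D a b)))

reverse-++⁻ : ∀ {A : Set} (w a {b} : List A) → reverse w ≡ a ++ b → w ≡ reverse b ++ reverse a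
reverse-++⁻ w a {b} eq =
  trans (sym (reverse-involutive w)) (trans (cong reverse eq) (reverse-++ a b))

replicate-∷ʳ : ∀ {A : Set} m (x : A) → replicate m x ++ x ∷ [] ≡ x ∷ replicate m x
replicate-∷ʳ zero    x = refl
replicate-∷ʳ (suc m) x = cong (x ∷_) (replicate-∷ʳ m x)

reverse-replicate : ∀ {A : Set} m (x : A) → reverse (replicate m x) ≡ replicate m x
reverse-replicate zero    x = refl
reverse-replicate (suc m) x =
  trans (unfold-reverse x (replicate m x)) (trans (cong (_∷ʳ x) (reverse-replicate m x)) (replicate-∷ʳ m x))

reverse-DUs : ∀ j → reverse (D ∷ replicate (suc (suc j)) U) ≡ replicate (j + 2) U ++ D ∷ []
reverse-DUs j = trans (unfold-reverse D (replicate (suc (suc j)) U))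
  (cong (_∷ʳ D) (trans (reverse-replicate (suc (suc j)) U) (cong (λ m → replicate m U) (+-comm 2 j))))

DyckAvoiding : ℕ → ℕ → List Step → Set
DyckAvoiding n j w = IsDyckPath n w × AvoidsFactor (replicate (j + 2) U ++ D ∷ []) w

dyckAvoiding⇒reads : ∀ {n j w} → DyckAvoiding n j w → Reads j n 0 j (reverse w)
dyckAvoiding⇒reads {n} {j} {w} ((u , d , prefixes) , avoids) =
  -- With no credit at the start, the reversed word cannot begin with `U`, so any start bound holds.
  d′ , trans u′ (sym (+-identityʳ n)) , ballot , (λ b eq → n≮0 (ballot [ U ] _ eq)) , bound
  where
  u′ = trans (count-reverse U w) u
  d′ = trans (count-reverse D w) d
  ballot : Ballot 0 (reverse w)
  ballot a b eq = complement-≤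
    (balanced-split a b (trans (cong (count U) (sym eq)) u′) (trans (cong (count D) (sym eq)) d′))
    (subst₂ _≤_ (count-reverse D b) (count-reverse U b)
      (prefixes (reverse b) (subst (Prefix _≡_ _) (sym (reverse-++⁻ w a eq)) (prefix-++⁺ (reverse b)))))
  bound : RunBound j (reverse w)
  bound a b eq = avoids (subst₂ (Infix _≡_) (reverse-DUs j) (sym w≡) (infix-++⁺ (reverse b)))
    where
    w≡ : w ≡ reverse b ++ reverse (D ∷ replicate (suc (suc j)) U) ++ reverse a
    w≡ = trans (reverse-++⁻ w (a ++ _) (trans eq (sym (++-assoc a _ b))))
               (cong (reverse b ++_) (reverse-++ a _))

reads⇒dyckAvoiding : ∀ {n j v} → Reads j n 0 j v → DyckAvoiding n j (reverse v)
reads⇒dyckAvoiding {n} {j} {v} (d , u , ballot , _ , bound) = (u′ , d′ , prefixes) , avoids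
  where
  u′ = trans (count-reverse U v) (trans u (+-identityʳ n))
  d′ = trans (count-reverse D v) d
  prefixes : ∀ p → Prefix _≡_ p (reverse v) → count D p ≤ count U p
  prefixes p pre with s , eq ← prefix-++⁻ pre = complement-≤
    (sym (balanced-split p s (trans (cong (count U) (sym eq)) u′) (trans (cong (count D) (sym eq)) d′)))
    (subst₂ _≤_ (count-reverse U s) (count-reverse D s)
      (ballot (reverse s) (reverse p) (reverse-++⁻ v p eq)))
  avoids : AvoidsFactor (replicate (j + 2) U ++ D ∷ []) (reverse v)
  avoids inf with a , b , eq ← infix-++⁻ inf =
    bound (reverse b) (reverse a) (trans (reverse-++⁻ v (a ++ DU) (trans eq′ (sym (++-assoc a DU b))))
      (trans (cong (reverse b ++_) (reverse-++ a DU))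
             (cong (λ x → reverse b ++ x ++ reverse a) (reverse-involutive _))))
    where
    DU = reverse (D ∷ replicate (suc (suc j)) U)
    eq′ = subst (λ x → reverse v ≡ a ++ x ++ b) (sym (reverse-DUs j)) eq

-- The two counts.

dyckAvoiding-cardinality : ∀ n j → HasCardinality (DyckAvoiding n j) (length (completions j n [] j))
dyckAvoiding-cardinality n j = enumeration⇒HasCardinality j (reverse ∘ steps j)
  (λ {c} {d} eq → steps-injective j c d (reverse-injective eq))
  (λ c → reads⇒dyckAvoiding (steps-reads j c))
  complete
  where
  complete : ∀ {w} → DyckAvoiding n j w → ∃[ c ] reverse (steps j {n} {[]} {j} c) ≡ w
  complete {w} dyck with c , eq ← reads⇒steps j [] (reverse w) (dyckAvoiding⇒reads dyck) =
    c , trans (cong reverse eq) (reverse-involutive w)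

oneTo↭↓ : ∀ n → map suc (upTo n) ↭ ↓ n
oneTo↭↓ n = map⁺ suc (↭-trans (↭-sym (↭-reverse (upTo n))) (↭-reflexive (reverse-upTo n)))

module _ {n π} (π↭↓ : π ↭ ↓ n) where

  permutation-≤ : All (_≤ n) π
  permutation-≤ = All-resp-↭⁻ π↭↓ (↓-≤ n)

  permutation-unique : Unique π
  permutation-unique =
    Unique-resp-↭ (↭⇒↭ₛ (↭-sym π↭↓)) (Unique.map⁺ suc-injective (Unique.downFrom⁺ n))

  permutation-threshold : Threshold [] n π
  permutation-threshold = All.map (λ y≤n → (λ n<y → contradiction n<y (≤⇒≯ y≤n)) , λ b ()) permutation-≤

BoundedPermutation : ℕ → ℕ → List ℕ → Set
BoundedPermutation n j π = IsPermutation n π × Avoids123 π × γᵁ π ≤ j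

boundedPermutation-cardinality :
  ∀ n j → HasCardinality (BoundedPermutation n j) (length (completions j n [] j))
boundedPermutation-cardinality n j = enumeration⇒HasCardinality j (entries j)
  (λ {c} {d} → entries-injective j [] c d) sound complete
  where
  sound : ∀ c → BoundedPermutation n j (entries j c)
  sound c =
    ↭-trans π↭↓ (↭-sym (oneTo↭↓ n)) ,
    no123⇒avoids123 (proj₂ (entries-no123 j c [] [])) ,
    blockBound⇒γᵁ≤ (proj₂ (runs⇒blockBound (permutation-unique π↭↓) [] ≤-refl refl
      (permutation-threshold π↭↓) (entries-runs j c [])))
    where π↭↓ = entries-↭ j c
  complete : ∀ {π} → BoundedPermutation n j π → ∃[ c ] entries j {n} {[]} {j} c ≡ π
  complete {π} (perm , av , γ≤j) = runs⇒entries j runs π↭↓ [] []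
    -- No entry exceeds n + 1, so the condition above the virtual minimum is vacuous.
    (⇒allPairs π (λ s n<x → contradiction n<x
      (<⇒≯ (s≤s (All.lookup (permutation-≤ π↭↓) (lookup s (here refl)))))))
    (avoids123⇒no123 π av)
    where
    π↭↓ = ↭-trans perm (oneTo↭↓ n)
    bound = γᵁ≤⇒blockBound (permutation-unique π↭↓) av γ≤j
    -- `bound []` serves as the start bound: a block at the front of π is a block at offset zero.
    runs = blockBound⇒runs (permutation-unique π↭↓) [] π refl
      (All-resp-↭⁻ π↭↓ (↓-positive n)) (permutation-threshold π↭↓) (bound []) bound

proposition5 : ∀ (n j : ℕ) → n ≥ 1 →
    ∃[ k ]
    HasCardinality (λ π → IsPermutation n π × Avoids123 π × γᵁ π ≤ j) k
    × HasCardinality (λ w → IsDyckPath n w × AvoidsFactor (replicate (j + 2) U ++ D ∷ []) w) k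
proposition5 n j _ = _ , boundedPermutation-cardinality n j , dyckAvoiding-cardinality n j
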